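{- There are absolute constants $c>0$ and $N$ such that for every diameter-2-critical graph $G$ with $n \ge N$ vertices, the average edge-degree of $G$ is at most $\left(\tfrac{6}{5}-c\right) n$; equivalently, if $G$ has $m$ edges and vertex degrees $d_v$, then $\sum_{v\in V(G)} d_v^2 \le \left(\tfrac{6}{5}-c\right) nm$.
   Context: All graphs are finite and simple. $d_G(x,y)$ denotes the length of a shortest $(x,y)$-path ($\infty$ if none exists), and the diameter of $G$ is the maximum of $d_G(x,y)$ over all vertex pairs. A graph $G$ is diameter-critical if for every edge $e$ the graph $G-e$ has strictly larger diameter than $G$; it is diameter-$k$-critical if moreover its diameter is $k$. The edge-degree of an edge $uv$ is $d_u+d_v$, and the average edge-degree is the mean of this over all edges, which equals $\frac1m\sum_v d_v^2$. -}

module Defs where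

open import Data.Bool using (Bool; true; false; _∧_; not; if_then_else_; _∨_)
open import Data.Nat using (ℕ; zero; suc; _+_; _*_; _≤_)
open import Data.Fin using (Fin; toℕ)
open import Data.Fin.Properties using (_≟_)
open import Data.List using (List; map; allFin)
open import Data.Nat.ListAction using (sum)
open import Data.Product using (Σ; _×_; _,_; ∃)
open import Relation.Binary.PropositionalEquality using (_≡_)
open import Relation.Nullary using (¬_)
open import Relation.Nullary.Decidable using (⌊_⌋)

record Graph (n : ℕ) : Set where
  field
    adj   : Fin n → Fin n → Bool
    sym   : ∀ x y → adj x y ≡ adj y x
    irrefl : ∀ x → adj x x ≡ false
open Graph public

isPair : ∀ {n} → Fin n → Fin n → Fin n → Fin n → Bool
isPair u v x y = (⌊ x ≟ u ⌋ ∧ ⌊ y ≟ v ⌋) ∨ (⌊ x ≟ v ⌋ ∧ ⌊ y ≟ u ⌋)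

deleteEdge : ∀ {n} → Graph n → Fin n → Fin n → Graph n
deleteEdge {n} G u v = record { adj = a ; sym = s ; irrefl = i }
  where
  a : Fin n → Fin n → Bool
  a x y = adj G x y ∧ not (isPair u v x y)
  lem : ∀ x y → isPair u v x y ≡ isPair u v y x
  lem x y with x Data.Fin.Properties.≟ u | x Data.Fin.Properties.≟ v | y Data.Fin.Properties.≟ u | y Data.Fin.Properties.≟ v
  ... | p1 | p2 | p3 | p4 = helper ⌊ p1 ⌋ ⌊ p2 ⌋ ⌊ p3 ⌋ ⌊ p4 ⌋
    where
    helper : ∀ b1 b2 b3 b4 → (b1 ∧ b4) ∨ (b2 ∧ b3) ≡ (b3 ∧ b2) ∨ (b4 ∧ b1)
    helper true  true  true  true  = Relation.Binary.PropositionalEquality.refl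
    helper true  true  true  false = Relation.Binary.PropositionalEquality.refl
    helper true  true  false true  = Relation.Binary.PropositionalEquality.refl
    helper true  true  false false = Relation.Binary.PropositionalEquality.refl
    helper true  false true  true  = Relation.Binary.PropositionalEquality.refl
    helper true  false true  false = Relation.Binary.PropositionalEquality.refl
    helper true  false false true  = Relation.Binary.PropositionalEquality.refl
    helper true  false false false = Relation.Binary.PropositionalEquality.refl
    helper false true  true  true  = Relation.Binary.PropositionalEquality.refl
    helper false true  true  false = Relation.Binary.PropositionalEquality.refl
    helper false true  false true  = Relation.Binary.PropositionalEquality.refl
    helper false true  false false = Relation.Binary.PropositionalEquality.refl
    helper false false true  true  = Relation.Binary.PropositionalEquality.refl
    helper false false true  false = Relation.Binary.PropositionalEquality.refl
    helper false false false true  = Relation.Binary.PropositionalEquality.refl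
    helper false false false false = Relation.Binary.PropositionalEquality.refl
  s : ∀ x y → a x y ≡ a y x
  s x y rewrite sym G x y | lem x y = Relation.Binary.PropositionalEquality.refl
  i : ∀ x → a x x ≡ false
  i x rewrite irrefl G x = Relation.Binary.PropositionalEquality.refl

data Walk {n : ℕ} (G : Graph n) : Fin n → Fin n → ℕ → Set where
  [] : ∀ {x} → Walk G x x zero
  _∷_ : ∀ {x y z k} → adj G x y ≡ true → Walk G y z k → Walk G x z (suc k)

-- d_G(x,y) ≤ k  (false when d_G(x,y) = ∞)
DistLe : ∀ {n} → Graph n → ℕ → Fin n → Fin n → Set
DistLe G k x y = ∃ λ ℓ → ℓ ≤ k × Walk G x y ℓ

DiamLe : ∀ {n} → Graph n → ℕ → Set
DiamLe G k = ∀ x y → DistLe G k x y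

HasDiam : ∀ {n} → Graph n → ℕ → Set
HasDiam G zero = DiamLe G zero
HasDiam G (suc k) = DiamLe G (suc k) × ¬ DiamLe G k

DiamCritical : ∀ {n} → Graph n → ℕ → Set
DiamCritical G k =
  HasDiam G k × (∀ u v → adj G u v ≡ true → ¬ DiamLe (deleteEdge G u v) k)

b2n : Bool → ℕ
b2n true = 1
b2n false = 0

degree : ∀ {n} → Graph n → Fin n → ℕ
degree {n} G v = sum (map (λ w → b2n (adj G v w)) (allFin n))

edgeCount : ∀ {n} → Graph n → ℕ
edgeCount {n} G =
  sum (map (λ x → sum (map (λ y → b2n (adj G x y ∧ ⌊ toℕ x Data.Nat.<? toℕ y ⌋)) (allFin n))) (allFin n))

sumSqDeg : ∀ {n} → Graph n → ℕ
sumSqDeg {n} G = sum (map (λ v → degree G v * degree G v) (allFin n))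

{-# OPTIONS --safe #-}

-- For an edge ab and a vertex w, the quantity [w ~ a] + [w ~ b] exceeds 1 only on triangles and
-- falls below 1 only when w is adjacent to neither end, so the average edge-degree is controlled
-- by comparing triangles with these "lonely" triples (ab; w).
--
-- Every edge uv of a triangle is needed for some distance-2 pair; say that v owns uv (v ⟶ u) when
-- the pair is u, y with v the unique common neighbour (a critical path u v y). If c owns an edge
-- to a or b in the triangle abc, with critical path ending in z, then (ab; z) is lonely and c is
-- determined by it. Since at least two vertices of each triangle own an edge of it, lonely triples
-- are at least twice as many as triangles, which alone gives the constant 6/5. The gain comes from
-- K₄'s: at least three of the four vertices of a K₄ abcd own one of its edges, and if c merely owns
-- cd then (ab; z) is still lonely, with c determined by d and z. Hence there are lonely triples to
-- spare unless K₄'s are few; but Σ d³ counts mostly K₄'s and is bounded below by convexity.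
-- Altogether 6 Σ d² ≤ 7 n m.

module Submission where

open import Defs
open import Data.Bool using (true; false; _∧_)
import Data.Bool.Properties as Bool
open import Data.Nat using (ℕ; zero; suc; _+_; _≥_; z≤n; s≤s)
import Data.Nat as ℕ
import Data.Nat.Properties as ℕ
open import Data.Nat.Tactic.RingSolver using (solve-∀)
import Data.Nat.ListAction as List
open import Data.Fin using (Fin; zero; suc; toℕ)
open import Data.Fin.Properties using (_≟_; any?; all?; toℕ-injective; suc-injective; 0≢1+n)
open import Data.List using (map; allFin; tabulate)
open import Data.List.Properties using (map-tabulate)
open import Data.Product using (Σ; _×_; _,_; ∃; proj₁; proj₂)
open import Data.Sum using (_⊎_; inj₁; inj₂; swap) renaming (map to map-⊎)
open import Data.Empty using (⊥; ⊥-elim)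
open import Function using (_∘_; id)
open import Relation.Nullary using (¬_; Dec; yes; no; does)
open import Relation.Nullary.Decidable using (⌊_⌋; _×-dec_; _⊎-dec_; _→-dec_; ¬?; decidable-stable)
open import Relation.Binary.PropositionalEquality as ≡ using (_≡_; _≢_; refl; cong; cong₂)
open import Algebra.Properties.Semiring.Sum ℕ.+-*-semiring
  using (sum; sum-syntax; sum-cong-≗; ∑-distrib-+; ∑-comm; *-distribˡ-sum; *-distribʳ-sum)

-- Finite sums and iterated sums over `Fin n`.

module Sums where

  open import Data.Nat using (_*_; _≤_)

  sum-mono-≤ : ∀ {n} {f g : Fin n → ℕ} → (∀ i → f i ≤ g i) → sum f ≤ sum g
  sum-mono-≤ {zero}  f≤g = z≤n
  sum-mono-≤ {suc n} f≤g = ℕ.+-mono-≤ (f≤g zero) (sum-mono-≤ (f≤g ∘ suc))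

  sum-const : ∀ n x → ∑[ _ < n ] x ≡ n * x
  sum-const zero    x = refl
  sum-const (suc n) x = cong (x +_) (sum-const n x)

  term≤sum : ∀ {n} (f : Fin n → ℕ) i → f i ≤ sum f
  term≤sum f zero    = ℕ.m≤m+n _ _
  term≤sum f (suc i) = ℕ.≤-trans (term≤sum (f ∘ suc) i) (ℕ.m≤n+m _ _)

  sum-*-sum : ∀ {m n} (f : Fin m → ℕ) (g : Fin n → ℕ) →
              sum f * sum g ≡ ∑[ i < m ] ∑[ j < n ] (f i * g j)
  sum-*-sum f g = ≡.trans (*-distribʳ-sum (sum g) f) (sum-cong-≗ λ i → *-distribˡ-sum (f i) g)

  sum-map-allFin : ∀ {n} (f : Fin n → ℕ) → List.sum (map f (allFin n)) ≡ sum f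
  sum-map-allFin {n} f = ≡.trans (cong List.sum (map-tabulate id f)) (sum-tabulate f)
    where
    sum-tabulate : ∀ {n} (f : Fin n → ℕ) → List.sum (tabulate f) ≡ sum f
    sum-tabulate {zero}  f = refl
    sum-tabulate {suc n} f = cong (f zero +_) (sum-tabulate (f ∘ suc))

  Σ₃ : ∀ {n} → (Fin n → Fin n → Fin n → ℕ) → ℕ
  Σ₃ {n} F = ∑[ a < n ] ∑[ b < n ] ∑[ c < n ] F a b c

  Σ₄ : ∀ {n} → (Fin n → Fin n → Fin n → Fin n → ℕ) → ℕ
  Σ₄ {n} F = ∑[ a < n ] Σ₃ (F a)

  Σ₃-mono : ∀ {n} {F H : Fin n → Fin n → Fin n → ℕ} →
            (∀ a b c → F a b c ≤ H a b c) → Σ₃ F ≤ Σ₃ H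
  Σ₃-mono F≤H = sum-mono-≤ λ a → sum-mono-≤ λ b → sum-mono-≤ λ c → F≤H a b c

  Σ₄-mono : ∀ {n} {F H : Fin n → Fin n → Fin n → Fin n → ℕ} →
            (∀ a b c d → F a b c d ≤ H a b c d) → Σ₄ F ≤ Σ₄ H
  Σ₄-mono F≤H = sum-mono-≤ λ a → Σ₃-mono (F≤H a)

  Σ₃-distrib-+ : ∀ {n} (F H : Fin n → Fin n → Fin n → ℕ) →
                 Σ₃ (λ a b c → F a b c + H a b c) ≡ Σ₃ F + Σ₃ H
  Σ₃-distrib-+ F H = ≡.trans
    (sum-cong-≗ λ a → ≡.trans (sum-cong-≗ λ b → ∑-distrib-+ (F a b) (H a b)) (∑-distrib-+ (sum ∘ F a) (sum ∘ H a)))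
    (∑-distrib-+ (λ a → sum (sum ∘ F a)) (λ a → sum (sum ∘ H a)))

  Σ₄-distrib-+ : ∀ {n} (F H : Fin n → Fin n → Fin n → Fin n → ℕ) →
                 Σ₄ (λ a b c d → F a b c d + H a b c d) ≡ Σ₄ F + Σ₄ H
  Σ₄-distrib-+ F H = ≡.trans (sum-cong-≗ λ a → Σ₃-distrib-+ (F a) (H a)) (∑-distrib-+ (Σ₃ ∘ F) (Σ₃ ∘ H))

  Σ₄-*ˡ : ∀ {n} k (F : Fin n → Fin n → Fin n → Fin n → ℕ) → k * Σ₄ F ≡ Σ₄ (λ a b c d → k * F a b c d)
  Σ₄-*ˡ k F = ≡.trans (*-distribˡ-sum k (Σ₃ ∘ F)) (sum-cong-≗ λ a →
    ≡.trans (*-distribˡ-sum k (λ b → sum (sum ∘ F a b))) (sum-cong-≗ λ b →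
    ≡.trans (*-distribˡ-sum k (sum ∘ F a b)) (sum-cong-≗ λ c → *-distribˡ-sum k (F a b c))))

  Σ₃-rotate : ∀ {n} (F : Fin n → Fin n → Fin n → ℕ) → Σ₃ (λ a b c → F b c a) ≡ Σ₃ F
  Σ₃-rotate F = ≡.trans (∑-comm (λ a b → ∑[ c < _ ] F b c a)) (sum-cong-≗ λ b → ∑-comm (λ a c → F b c a))

  Σ₄-rotate : ∀ {n} (F : Fin n → Fin n → Fin n → Fin n → ℕ) → Σ₄ (λ a b c d → F b c d a) ≡ Σ₄ F
  Σ₄-rotate F = ≡.trans (∑-comm (λ a b → ∑[ c < _ ] ∑[ d < _ ] F b c d a)) (sum-cong-≗ λ b → Σ₃-rotate (F b))

  Σ₄-const₄ : ∀ {n} (F : Fin n → Fin n → Fin n → ℕ) → Σ₄ (λ a b c d → F a b c) ≡ n * Σ₃ F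
  Σ₄-const₄ {n} F = ≡.trans (≡.sym (Σ₄-rotate (λ a b c d → F a b c))) (sum-const n (Σ₃ F))

  Σ₄-const₃ : ∀ {n} (F : Fin n → Fin n → Fin n → ℕ) → Σ₄ (λ a b c d → F a b d) ≡ n * Σ₃ F
  Σ₄-const₃ {n} F = ≡.trans
    (sum-cong-≗ λ a → sum-cong-≗ λ b → ∑-comm (λ (c d : Fin n) → F a b d)) (Σ₄-const₄ F)

  Σ₄-const₂ : ∀ {n} (F : Fin n → Fin n → Fin n → ℕ) → Σ₄ (λ a b c d → F a c d) ≡ n * Σ₃ F
  Σ₄-const₂ {n} F = ≡.trans
    (sum-cong-≗ λ a → ∑-comm (λ (b c : Fin n) → ∑[ d < n ] F a c d)) (Σ₄-const₃ F)

open Sums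

-- Counting with indicators of decidable propositions.

module Indicators where

  open import Data.Nat using (_*_; _≤_)

  𝟙 : {P : Set} → Dec P → ℕ
  𝟙 p = b2n (does p)

  𝟙-mono : {P Q : Set} (p : Dec P) (q : Dec Q) → (P → Q) → 𝟙 p ≤ 𝟙 q
  𝟙-mono (no _)  q        _   = z≤n
  𝟙-mono (yes x) (yes _)  _   = ℕ.≤-refl
  𝟙-mono (yes x) (no ¬y)  P→Q = ⊥-elim (¬y (P→Q x))

  𝟙-scale : ∀ k {x} {P : Set} (p : Dec P) → (P → k ≤ x) → k * 𝟙 p ≤ x
  𝟙-scale k (yes p) h = ℕ.≤-trans (ℕ.≤-reflexive (ℕ.*-identityʳ k)) (h p)
  𝟙-scale k (no _)  h = ℕ.≤-trans (ℕ.≤-reflexive (ℕ.*-zeroʳ k)) z≤n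

  𝟙-× : {P Q : Set} (p : Dec P) (q : Dec Q) → 𝟙 p * 𝟙 q ≡ 𝟙 (p ×-dec q)
  𝟙-× (no _)  q       = refl
  𝟙-× (yes _) (yes _) = refl
  𝟙-× (yes _) (no _)  = refl

  𝟙-⊎ : {P Q : Set} (p : Dec P) (q : Dec Q) → 𝟙 (p ⊎-dec q) ≤ 𝟙 p + 𝟙 q
  𝟙-⊎ (yes _) q = s≤s z≤n
  𝟙-⊎ (no _)  q = ℕ.≤-refl

  𝟙-disjoint : {P Q R : Set} (p : Dec P) (q : Dec Q) (r : Dec R) →
               (P → R) → (Q → R) → (P → Q → ⊥) → 𝟙 p + 𝟙 q ≤ 𝟙 r
  𝟙-disjoint (yes x) (yes y) r       _   _   ¬PQ = ⊥-elim (¬PQ x y)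
  𝟙-disjoint (no _)  q       r       _   Q→R _   = 𝟙-mono q r Q→R
  𝟙-disjoint (yes x) (no _)  r       P→R _   _   = 𝟙-mono (yes x) r P→R

  𝟙-∃ : ∀ {n} {P : Set} {Q : Fin n → Set} (p : Dec P) (q : ∀ i → Dec (Q i)) →
        (P → ∃ Q) → 𝟙 p ≤ ∑[ i < n ] 𝟙 (q i)
  𝟙-∃ (no _)  q _ = z≤n
  𝟙-∃ (yes x) q P→∃Q with P→∃Q x
  ... | i , y = ℕ.≤-trans (𝟙-mono (yes y) (q i) id) (term≤sum (𝟙 ∘ q) i)

  -- Induction on `n`: a witness at `zero` and one among the successors would have equal indices, so
  -- the two cases are disjoint events inside `P`.
  𝟙-unique : ∀ {n} {P : Set} {Q : Fin n → Set} (p : Dec P) (q : ∀ i → Dec (Q i)) →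
             (∀ {i} → Q i → P) → (∀ {i j} → Q i → Q j → i ≡ j) → ∑[ i < n ] 𝟙 (q i) ≤ 𝟙 p
  𝟙-unique {zero}  p q Q→P Q-unique = z≤n
  𝟙-unique {suc n} {Q = Q} p q Q→P Q-unique = ℕ.≤-trans
    (ℕ.+-monoʳ-≤ (𝟙 (q zero)) (𝟙-unique (any? (q ∘ suc)) (q ∘ suc) (λ y → _ , y)
      λ x y → suc-injective (Q-unique x y)))
    (𝟙-disjoint (q zero) (any? (q ∘ suc)) p Q→P (Q→P ∘ proj₂) λ x (i , y) → 0≢1+n (Q-unique x y))

  -- Read the propositions as vertices of a triangle with one hypothesis per edge: a vertex cover of
  -- a complete graph misses at most one vertex.
  two-of-three : {P Q R : Set} (p : Dec P) (q : Dec Q) (r : Dec R) →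
                 P ⊎ Q → Q ⊎ R → R ⊎ P → 2 ≤ 𝟙 p + (𝟙 q + 𝟙 r)
  two-of-three (yes _) (yes _) r       _ _ _ = s≤s (s≤s z≤n)
  two-of-three (yes _) (no _)  (yes _) _ _ _ = s≤s (s≤s z≤n)
  two-of-three (no _)  (yes _) (yes _) _ _ _ = s≤s (s≤s z≤n)
  two-of-three (no ¬x) (no ¬y) r  (inj₁ x) _ _ = ⊥-elim (¬x x)
  two-of-three (no ¬x) (no ¬y) r  (inj₂ y) _ _ = ⊥-elim (¬y y)
  two-of-three (yes _) (no ¬y) (no ¬z) _ (inj₁ y) _ = ⊥-elim (¬y y)
  two-of-three (yes _) (no ¬y) (no ¬z) _ (inj₂ z) _ = ⊥-elim (¬z z)
  two-of-three (no ¬x) (yes _) (no ¬z) _ _ (inj₁ z) = ⊥-elim (¬z z)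
  two-of-three (no ¬x) (yes _) (no ¬z) _ _ (inj₂ x) = ⊥-elim (¬x x)

  -- The same vertex-cover count on four vertices. If `P` holds, `two-of-three` handles the rest; if
  -- `P` fails, all the others are forced.
  three-of-four : {P Q R S : Set} (p : Dec P) (q : Dec Q) (r : Dec R) (s : Dec S) →
                  P ⊎ Q → Q ⊎ R → R ⊎ P → P ⊎ S → Q ⊎ S → R ⊎ S → 3 ≤ 𝟙 p + (𝟙 q + (𝟙 r + 𝟙 s))
  three-of-four (yes _) q r s _ qr _ _ qs rs =
    s≤s (two-of-three q r s qr rs (swap qs))
  three-of-four (no _) (yes _) (yes _) (yes _) _ _ _ _ _ _ = s≤s (s≤s (s≤s z≤n))
  three-of-four (no ¬x) (no ¬y) r s (inj₁ x) _ _ _ _ _ = ⊥-elim (¬x x)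
  three-of-four (no ¬x) (no ¬y) r s (inj₂ y) _ _ _ _ _ = ⊥-elim (¬y y)
  three-of-four (no ¬x) (yes _) (no ¬z) s _ _ (inj₁ z) _ _ _ = ⊥-elim (¬z z)
  three-of-four (no ¬x) (yes _) (no ¬z) s _ _ (inj₂ x) _ _ _ = ⊥-elim (¬x x)
  three-of-four (no ¬x) (yes _) (yes _) (no ¬w) _ _ _ (inj₁ x) _ _ = ⊥-elim (¬x x)
  three-of-four (no ¬x) (yes _) (yes _) (no ¬w) _ _ _ (inj₂ w) _ _ = ⊥-elim (¬w w)

open Indicators

-- Critical paths and ownership of triangle edges.

module CriticalPaths {n : ℕ} (G : Graph n) where

  infix 4 _~_ _~?_ _⟶_ _⟶?_

  _~_ : Fin n → Fin n → Set
  x ~ y = adj G x y ≡ true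

  _~?_ : ∀ x y → Dec (x ~ y)
  x ~? y = adj G x y Bool.≟ true

  ~-sym : ∀ {x y} → x ~ y → y ~ x
  ~-sym {x} {y} xy = ≡.trans (sym G y x) xy

  ~-irrefl : ∀ {x y} → x ≡ y → ¬ (x ~ y)
  ~-irrefl {x} refl xx with ≡.trans (≡.sym xx) (irrefl G x)
  ... | ()

  -- In use u ~ v as well, so u v y is the only path of length at most 2 from u to y.
  Crit : Fin n → Fin n → Fin n → Set
  Crit u v y = v ~ y × ¬ (u ~ y) × (∀ w → u ~ w → w ~ y → w ≡ v)

  crit? : ∀ u v y → Dec (Crit u v y)
  crit? u v y = (v ~? y) ×-dec ¬? (u ~? y) ×-dec all? λ w → (u ~? w) →-dec ((w ~? y) →-dec (w ≟ v))

  _⟶_ : Fin n → Fin n → Set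
  v ⟶ u = ∃ (Crit u v)

  _⟶?_ : ∀ v u → Dec (v ⟶ u)
  v ⟶? u = any? (crit? u v)

  -- If the finite search for another common neighbour fails, `v` is the only one and `y` witnesses
  -- `v ⟶ u`.
  second-common-neighbour : ∀ {u v y} → ¬ (v ⟶ u) → v ~ y → ¬ (u ~ y) →
                            ∃ λ w → u ~ w × w ~ y × w ≢ v
  second-common-neighbour {u} {v} {y} ¬v⟶u vy ¬uy
    with any? (λ w → (u ~? w) ×-dec (w ~? y) ×-dec ¬? (w ≟ v))
  ... | yes found = found
  ... | no ¬found = ⊥-elim (¬v⟶u (y , vy , ¬uy , λ w uw wy →
    decidable-stable (w ≟ v) λ w≢v → ¬found (w , uw , wy , w≢v)))

  -- Refutes the case of an unowned triangle edge: a pair that used `uv` is rerouted through `t` if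
  -- it is the pair `u`, `v` itself, and through a second common neighbour otherwise.
  module Deletion {u v t : Fin n} (tu : t ~ u) (tv : t ~ v) (¬u⟶v : ¬ (u ⟶ v)) (¬v⟶u : ¬ (v ⟶ u)) where

    Same : Fin n → Fin n → Set
    Same x y = (x ≡ u × y ≡ v) ⊎ (x ≡ v × y ≡ u)

    same? : ∀ x y → Dec (Same x y)
    same? x y = ((x ≟ u) ×-dec (y ≟ v)) ⊎-dec ((x ≟ v) ×-dec (y ≟ u))

    survives : ∀ {x y} → x ~ y → ¬ Same x y → adj (deleteEdge G u v) x y ≡ true
    survives {x} {y} xy ¬same rewrite xy with x ≟ u | y ≟ v | x ≟ v | y ≟ u
    ... | yes p | yes q | _     | _     = ⊥-elim (¬same (inj₁ (p , q)))
    ... | yes p | no  q | yes r | yes s = ⊥-elim (¬same (inj₂ (r , s)))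
    ... | no  p | _     | yes r | yes s = ⊥-elim (¬same (inj₂ (r , s)))
    ... | yes p | no  q | no  r | _     = refl
    ... | yes p | no  q | yes r | no  s = refl
    ... | no  p | _     | no  r | _     = refl
    ... | no  p | _     | yes r | no  s = refl

    Near : Fin n → Fin n → Set
    Near = DistLe (deleteEdge G u v) 2

    near₂ : ∀ {x y z} → adj (deleteEdge G u v) x y ≡ true → adj (deleteEdge G u v) y z ≡ true → Near x z
    near₂ xy yz = 2 , ℕ.≤-refl , (xy ∷ (yz ∷ []))

    detour : ∀ {x w y} → w ≢ u → w ≢ v → x ~ w → w ~ y → Near x y
    detour w≢u w≢v xw wy = near₂
      (survives xw λ { (inj₁ (_ , w≡v)) → w≢v w≡v ; (inj₂ (_ , w≡u)) → w≢u w≡u })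
      (survives wy λ { (inj₁ (w≡u , _)) → w≢u w≡u ; (inj₂ (w≡v , _)) → w≢v w≡v })

    near-adjacent : ∀ {x y} → x ~ y → Near x y
    near-adjacent {x} {y} xy with same? x y
    ... | no ¬same = 1 , s≤s z≤n , (survives xy ¬same ∷ [])
    ... | yes (inj₁ (refl , refl)) = detour (λ e → ~-irrefl e tu) (λ e → ~-irrefl e tv) (~-sym tu) tv
    ... | yes (inj₂ (refl , refl)) = detour (λ e → ~-irrefl e tu) (λ e → ~-irrefl e tv) (~-sym tv) tu

    -- If `uv` is the first edge, then `p` does not own the edge to `x`, so `x` and `y` have a
    -- common neighbour other than `p`. It also differs from `x`, being adjacent to it, so it avoids
    -- both `u` and `v`. If `uv` is the second edge, the same argument applies to the reversed path.
    near-path : ∀ {x p y} → x ~ p → p ~ y → ¬ (x ~ y) → Near x y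
    near-path {x} {p} {y} xp py ¬xy with same? x p | same? p y
    ... | no ¬xp | no ¬py = near₂ (survives xp ¬xp) (survives py ¬py)
    ... | yes (inj₁ (refl , refl)) | _ =
      let (w , xw , wy , w≢v) = second-common-neighbour ¬v⟶u py ¬xy
      in detour (λ e → ~-irrefl (≡.sym e) xw) w≢v xw wy
    ... | yes (inj₂ (refl , refl)) | _ =
      let (w , xw , wy , w≢u) = second-common-neighbour ¬u⟶v py ¬xy
      in detour w≢u (λ e → ~-irrefl (≡.sym e) xw) xw wy
    ... | no _ | yes (inj₁ (refl , refl)) =
      let (w , yw , wx , w≢u) = second-common-neighbour ¬u⟶v (~-sym xp) (¬xy ∘ ~-sym)
      in detour w≢u (λ e → ~-irrefl (≡.sym e) yw) (~-sym wx) (~-sym yw)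
    ... | no _ | yes (inj₂ (refl , refl)) =
      let (w , yw , wx , w≢v) = second-common-neighbour ¬v⟶u (~-sym xp) (¬xy ∘ ~-sym)
      in detour (λ e → ~-irrefl (≡.sym e) yw) w≢v (~-sym wx) (~-sym yw)

    diamLe-delete : DiamLe G 2 → DiamLe (deleteEdge G u v) 2
    diamLe-delete diam x y with diam x y
    ... | 0 , _ , [] = 0 , z≤n , []
    ... | 1 , _ , (xy ∷ []) = near-adjacent xy
    ... | 2 , _ , (xp ∷ (py ∷ [])) with x ~? y
    ...   | yes xy = near-adjacent xy
    ...   | no ¬xy = near-path xp py ¬xy
    diamLe-delete diam x y | suc (suc (suc _)) , s≤s (s≤s ()) , _

  -- Otherwise deleting `uv` would keep the diameter at most 2. All later appeals to criticality go
  -- through this lemma.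
  triangle-edge-owned : DiamCritical G 2 → ∀ {u v t} → u ~ v → t ~ u → t ~ v → (u ⟶ v) ⊎ (v ⟶ u)
  triangle-edge-owned ((diam , _) , critical) {u} {v} uv tu tv with u ⟶? v | v ⟶? u
  ... | yes u⟶v | _       = inj₁ u⟶v
  ... | no _    | yes v⟶u = inj₂ v⟶u
  ... | no ¬u⟶v | no ¬v⟶u = ⊥-elim (critical u v uv (Deletion.diamLe-delete tu tv ¬u⟶v ¬v⟶u diam))

-- Degree sums against triangles, cherries, lonely triples and K₄'s.

module Counting {n : ℕ} (G : Graph n) where

  open import Data.Nat using (_*_; _≤_)
  open CriticalPaths G
  open ℕ.≤-Reasoning

  -- The last edge is written `c ~ a`, so rotating the vertices only permutes the components.
  Triangle : Fin n → Fin n → Fin n → Set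
  Triangle a b c = a ~ b × b ~ c × c ~ a

  -- The leaves `b` and `c` may coincide, as adjacency is irreflexive; the diagonal pairs in
  -- `deg a * deg a` thus count as cherries.
  Cherry : Fin n → Fin n → Fin n → Set
  Cherry a b c = a ~ b × a ~ c × ¬ (b ~ c)

  Lonely : Fin n → Fin n → Fin n → Set
  Lonely a b z = a ~ b × ¬ (a ~ z) × ¬ (b ~ z)

  K₄ : Fin n → Fin n → Fin n → Fin n → Set
  K₄ a b c d = Triangle a b c × a ~ d × b ~ d × c ~ d

  triangle? : ∀ a b c → Dec (Triangle a b c)
  triangle? a b c = (a ~? b) ×-dec (b ~? c) ×-dec (c ~? a)

  cherry? : ∀ a b c → Dec (Cherry a b c)
  cherry? a b c = (a ~? b) ×-dec (a ~? c) ×-dec ¬? (b ~? c)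

  lonely? : ∀ a b z → Dec (Lonely a b z)
  lonely? a b z = (a ~? b) ×-dec ¬? (a ~? z) ×-dec ¬? (b ~? z)

  k₄? : ∀ a b c d → Dec (K₄ a b c d)
  k₄? a b c d = triangle? a b c ×-dec (a ~? d) ×-dec (b ~? d) ×-dec (c ~? d)

  -- All of these count ordered tuples.
  #triangle #cherry #lonely #k₄ : ℕ
  #triangle = Σ₃ λ a b c → 𝟙 (triangle? a b c)
  #cherry   = Σ₃ λ a b c → 𝟙 (cherry? a b c)
  #lonely   = Σ₃ λ a b z → 𝟙 (lonely? a b z)
  #k₄       = Σ₄ λ a b c d → 𝟙 (k₄? a b c d)

  deg : Fin n → ℕ
  deg a = ∑[ b < n ] 𝟙 (a ~? b)

  #arcs : ℕ
  #arcs = sum deg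

  Σdeg² Σdeg³ : ℕ
  Σdeg² = ∑[ a < n ] (deg a * deg a)
  Σdeg³ = ∑[ a < n ] (deg a * (deg a * deg a))

  deg²≡ : ∀ a → deg a * deg a ≡ ∑[ b < n ] ∑[ c < n ] 𝟙 ((a ~? b) ×-dec (a ~? c))
  deg²≡ a = ≡.trans (sum-*-sum (𝟙 ∘ (a ~?_)) (𝟙 ∘ (a ~?_)))
    (sum-cong-≗ λ b → sum-cong-≗ λ c → 𝟙-× (a ~? b) (a ~? c))

  deg³≡ : ∀ a → deg a * (deg a * deg a) ≡
                ∑[ b < n ] ∑[ c < n ] ∑[ d < n ] 𝟙 ((a ~? b) ×-dec ((a ~? c) ×-dec (a ~? d)))
  deg³≡ a = ≡.trans (cong (deg a *_) (deg²≡ a)) (≡.trans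
    (sum-*-sum (𝟙 ∘ (a ~?_)) (λ c → ∑[ d < n ] 𝟙 ((a ~? c) ×-dec (a ~? d))))
    (sum-cong-≗ λ b → sum-cong-≗ λ c → ≡.trans
      (*-distribˡ-sum (𝟙 (a ~? b)) (λ d → 𝟙 ((a ~? c) ×-dec (a ~? d))))
      (sum-cong-≗ λ d → 𝟙-× (a ~? b) ((a ~? c) ×-dec (a ~? d)))))

  Σdeg²≤ : Σdeg² ≤ #triangle + #cherry
  Σdeg²≤ = begin
    Σdeg²
      ≡⟨ sum-cong-≗ deg²≡ ⟩
    Σ₃ (λ a b c → 𝟙 ((a ~? b) ×-dec (a ~? c)))
      ≤⟨ Σ₃-mono pointwise ⟩
    Σ₃ (λ a b c → 𝟙 (triangle? a b c) + 𝟙 (cherry? a b c))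
      ≡⟨ Σ₃-distrib-+ (λ a b c → 𝟙 (triangle? a b c)) (λ a b c → 𝟙 (cherry? a b c)) ⟩
    #triangle + #cherry ∎
    where
    cover : ∀ a b c → a ~ b × a ~ c → Triangle a b c ⊎ Cherry a b c
    cover a b c (ab , ac) with b ~? c
    ... | yes bc = inj₁ (ab , bc , ~-sym ac)
    ... | no ¬bc = inj₂ (ab , ac , ¬bc)
    pointwise : ∀ a b c → 𝟙 ((a ~? b) ×-dec (a ~? c)) ≤ 𝟙 (triangle? a b c) + 𝟙 (cherry? a b c)
    pointwise a b c = ℕ.≤-trans
      (𝟙-mono ((a ~? b) ×-dec (a ~? c)) (triangle? a b c ⊎-dec cherry? a b c) (cover a b c))
      (𝟙-⊎ (triangle? a b c) (cherry? a b c))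

  -- Three neighbours of `a` either are pairwise adjacent or contain a non-adjacent pair. That pair
  -- forms a cherry at `a`, sits in one of three positions, and leaves the remaining vertex at most
  -- `n` choices.
  Σdeg³≤ : Σdeg³ ≤ #k₄ + 3 * (n * #cherry)
  Σdeg³≤ = begin
    Σdeg³
      ≡⟨ sum-cong-≗ deg³≡ ⟩
    Σ₄ (λ a b c d → 𝟙 ((a ~? b) ×-dec ((a ~? c) ×-dec (a ~? d))))
      ≤⟨ Σ₄-mono pointwise ⟩
    Σ₄ (λ a b c d → 𝟙 (k₄? a b c d) + (ch a b c + (ch a b d + ch a c d)))
      ≡⟨ Σ₄-distrib-+ (λ a b c d → 𝟙 (k₄? a b c d)) _ ⟩
    #k₄ + Σ₄ (λ a b c d → ch a b c + (ch a b d + ch a c d))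
      ≡⟨ cong (_+_ #k₄) (≡.trans (Σ₄-distrib-+ (λ a b c d → ch a b c) _)
           (cong₂ _+_ (Σ₄-const₄ ch) (≡.trans (Σ₄-distrib-+ (λ a b c d → ch a b d) _)
             (cong₂ _+_ (Σ₄-const₃ ch) (Σ₄-const₂ ch))))) ⟩
    #k₄ + (n * #cherry + (n * #cherry + n * #cherry))
      ≡⟨ tidy #k₄ (n * #cherry) ⟩
    #k₄ + 3 * (n * #cherry) ∎
    where
    ch : Fin n → Fin n → Fin n → ℕ
    ch a b c = 𝟙 (cherry? a b c)
    tidy : ∀ q x → q + (x + (x + x)) ≡ q + 3 * x
    tidy = solve-∀
    cover : ∀ a b c d → a ~ b × a ~ c × a ~ d →
            K₄ a b c d ⊎ Cherry a b c ⊎ Cherry a b d ⊎ Cherry a c d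
    cover a b c d (ab , ac , ad) with b ~? c | b ~? d | c ~? d
    ... | yes bc | yes bd | yes cd = inj₁ ((ab , bc , ~-sym ac) , ad , bd , cd)
    ... | no ¬bc | _      | _      = inj₂ (inj₁ (ab , ac , ¬bc))
    ... | yes _  | no ¬bd | _      = inj₂ (inj₂ (inj₁ (ab , ad , ¬bd)))
    ... | yes _  | yes _  | no ¬cd = inj₂ (inj₂ (inj₂ (ac , ad , ¬cd)))
    pointwise : ∀ a b c d → 𝟙 ((a ~? b) ×-dec ((a ~? c) ×-dec (a ~? d))) ≤
                            𝟙 (k₄? a b c d) + (ch a b c + (ch a b d + ch a c d))
    pointwise a b c d = begin
      𝟙 ((a ~? b) ×-dec ((a ~? c) ×-dec (a ~? d)))
        ≤⟨ 𝟙-mono ((a ~? b) ×-dec ((a ~? c) ×-dec (a ~? d))) (K ⊎-dec (x ⊎-dec (y ⊎-dec z))) (cover a b c d) ⟩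
      𝟙 (K ⊎-dec (x ⊎-dec (y ⊎-dec z)))
        ≤⟨ 𝟙-⊎ K (x ⊎-dec (y ⊎-dec z)) ⟩
      𝟙 K + 𝟙 (x ⊎-dec (y ⊎-dec z))
        ≤⟨ ℕ.+-monoʳ-≤ (𝟙 K) (ℕ.≤-trans (𝟙-⊎ x (y ⊎-dec z)) (ℕ.+-monoʳ-≤ (𝟙 x) (𝟙-⊎ y z))) ⟩
      𝟙 K + (𝟙 x + (𝟙 y + 𝟙 z)) ∎
      where
      K = k₄? a b c d
      x = cherry? a b c
      y = cherry? a b d
      z = cherry? a c d

  -- The sum of d (2d - n)² ≥ 0 over the degrees d.
  Σdeg²≤Σdeg³ : 4 * (n * Σdeg²) ≤ 4 * Σdeg³ + n * n * #arcs
  Σdeg²≤Σdeg³ = begin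
    4 * (n * Σdeg²)
      ≡⟨ cong (4 *_) (*-distribˡ-sum n (λ a → deg a * deg a)) ⟩
    4 * sum (λ a → n * (deg a * deg a))
      ≡⟨ *-distribˡ-sum 4 (λ a → n * (deg a * deg a)) ⟩
    sum (λ a → 4 * (n * (deg a * deg a)))
      ≤⟨ sum-mono-≤ (λ a → convexity (deg a)) ⟩
    sum (λ a → 4 * (deg a * (deg a * deg a)) + n * n * deg a)
      ≡⟨ ∑-distrib-+ (λ a → 4 * (deg a * (deg a * deg a))) (λ a → n * n * deg a) ⟩
    sum (λ a → 4 * (deg a * (deg a * deg a))) + sum (λ a → n * n * deg a)
      ≡⟨ cong₂ _+_ (*-distribˡ-sum 4 (λ a → deg a * (deg a * deg a))) (*-distribˡ-sum (n * n) deg) ⟨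
    4 * Σdeg³ + n * n * #arcs ∎
    where
    am-gm : ∀ x y → 2 * (x * y) ≤ x * x + y * y
    am-gm x y with ℕ.≤-total x y
    ... | inj₁ x≤y with ℕ.m≤n⇒∃[o]m+o≡n x≤y
    ...   | k , refl = ℕ.≤-trans (ℕ.m≤m+n _ (k * k)) (ℕ.≤-reflexive (square x k))
      where
      square : ∀ x k → 2 * (x * (x + k)) + k * k ≡ x * x + (x + k) * (x + k)
      square = solve-∀
    am-gm x y | inj₂ y≤x with ℕ.m≤n⇒∃[o]m+o≡n y≤x
    ...   | k , refl = ℕ.≤-trans (ℕ.m≤m+n _ (k * k)) (ℕ.≤-reflexive (square y k))
      where
      square : ∀ y k → 2 * ((y + k) * y) + k * k ≡ (y + k) * (y + k) + y * y
      square = solve-∀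
    convexity : ∀ d → 4 * (n * (d * d)) ≤ 4 * (d * (d * d)) + n * n * d
    convexity d = begin
      4 * (n * (d * d))                       ≡⟨ lhs n d ⟩
      2 * (2 * d * n) * d                     ≤⟨ ℕ.*-monoˡ-≤ d (am-gm (2 * d) n) ⟩
      (2 * d * (2 * d) + n * n) * d           ≡⟨ rhs n d ⟩
      4 * (d * (d * d)) + n * n * d           ∎
      where
      lhs : ∀ n d → 4 * (n * (d * d)) ≡ 2 * (2 * d * n) * d
      lhs = solve-∀
      rhs : ∀ n d → (2 * d * (2 * d) + n * n) * d ≡ 4 * (d * (d * d)) + n * n * d
      rhs = solve-∀

  -- For an arc `ab`, a vertex `w` is adjacent to both ends, to `a` only, to `b` only, or to
  -- neither; these cases are exclusive. Each of the two middle ones contributes one `#cherry`.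
  triples-on-edges : (#triangle + #cherry) + (#cherry + #lonely) ≤ n * #arcs
  triples-on-edges = begin
    (#triangle + #cherry) + (#cherry + #lonely)
      -- Exchanging `a` and `b` makes the second `#cherry` count cherries centred at `b`.
      ≡⟨ cong (λ s → (#triangle + #cherry) + (s + #lonely))
              (∑-comm (λ a b → ∑[ w < n ] 𝟙 (cherry? a b w))) ⟩
    (Σ₃ t + Σ₃ x) + (Σ₃ y + Σ₃ l)
      ≡⟨ cong₂ _+_ (Σ₃-distrib-+ t x) (Σ₃-distrib-+ y l) ⟨
    Σ₃ (λ a b w → t a b w + x a b w) + Σ₃ (λ a b w → y a b w + l a b w)
      ≡⟨ Σ₃-distrib-+ (λ a b w → t a b w + x a b w) (λ a b w → y a b w + l a b w) ⟨
    Σ₃ (λ a b w → (t a b w + x a b w) + (y a b w + l a b w))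
      ≤⟨ Σ₃-mono pointwise ⟩
    Σ₃ (λ a b w → 𝟙 (a ~? b))
      ≡⟨ Σ₃-rotate (λ a b w → 𝟙 (a ~? b)) ⟨
    Σ₃ (λ w a b → 𝟙 (a ~? b))
      ≡⟨ sum-const n #arcs ⟩
    n * #arcs ∎
    where
    t x y l : Fin n → Fin n → Fin n → ℕ
    t a b w = 𝟙 (triangle? a b w)
    x a b w = 𝟙 (cherry? a b w)
    y a b w = 𝟙 (cherry? b a w)
    l a b w = 𝟙 (lonely? a b w)
    pointwise : ∀ a b w → (t a b w + x a b w) + (y a b w + l a b w) ≤ 𝟙 (a ~? b)
    pointwise a b w = ℕ.≤-trans
      (ℕ.+-mono-≤
        (𝟙-disjoint (triangle? a b w) (cherry? a b w) near
          (λ { (ab , bw , wa) → ab , ~-sym wa }) (λ { (ab , aw , ¬bw) → ab , aw })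
          λ { (_ , bw , _) (_ , _ , ¬bw) → ¬bw bw })
        (𝟙-disjoint (cherry? b a w) (lonely? a b w) far
          (λ { (ba , bw , ¬aw) → ~-sym ba , ¬aw }) (λ { (ab , ¬aw , _) → ab , ¬aw })
          λ { (_ , bw , _) (_ , _ , ¬bw) → ¬bw bw }))
      (𝟙-disjoint near far (a ~? b) proj₁ proj₁ λ { (_ , aw) (_ , ¬aw) → ¬aw aw })
      where
      near = (a ~? b) ×-dec (a ~? w)
      far  = (a ~? b) ×-dec ¬? (a ~? w)

  -- Owners in triangles and K₄'s, and the lonely triples they certify.

  K₄-rotate : ∀ {a b c d} → K₄ a b c d → K₄ b c d a
  K₄-rotate ((ab , bc , ca) , ad , bd , cd) = (bc , cd , ~-sym bd) , ~-sym ab , ca , ~-sym ad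

  K₄-rotate₃ : ∀ {a b c d} → K₄ a b c d → K₄ b c a d
  K₄-rotate₃ ((ab , bc , ca) , ad , bd , cd) = (bc , ca , ab) , bd , cd , ad

  -- The extra vertex `d` puts triangles into the same fourfold sums as K₄'s: each triangle with a
  -- fourth vertex is of exactly one of the two kinds.
  LoneTriangle : Fin n → Fin n → Fin n → Fin n → Set
  LoneTriangle a b c d = Triangle a b c × ¬ K₄ a b c d

  loneTriangle? : ∀ a b c d → Dec (LoneTriangle a b c d)
  loneTriangle? a b c d = triangle? a b c ×-dec ¬? (k₄? a b c d)

  TriangleOwner : Fin n → Fin n → Fin n → Fin n → Set
  TriangleOwner a b c d = LoneTriangle a b c d × ((c ⟶ a) ⊎ (c ⟶ b))

  triangleOwner? : ∀ a b c d → Dec (TriangleOwner a b c d)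
  triangleOwner? a b c d = loneTriangle? a b c d ×-dec ((c ⟶? a) ⊎-dec (c ⟶? b))

  -- Counting the edge to `d` as well raises the guaranteed share of owners from two in three to
  -- three in four.
  K₄Owner : Fin n → Fin n → Fin n → Fin n → Set
  K₄Owner a b c d = K₄ a b c d × ((c ⟶ a) ⊎ (c ⟶ b) ⊎ (c ⟶ d))

  k₄Owner? : ∀ a b c d → Dec (K₄Owner a b c d)
  k₄Owner? a b c d = k₄? a b c d ×-dec ((c ⟶? a) ⊎-dec (c ⟶? b) ⊎-dec (c ⟶? d))

  #loneTriangle #triangleOwner #k₄Owner : ℕ
  #loneTriangle  = Σ₄ λ a b c d → 𝟙 (loneTriangle? a b c d)
  #triangleOwner = Σ₄ λ a b c d → 𝟙 (triangleOwner? a b c d)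
  #k₄Owner       = Σ₄ λ a b c d → 𝟙 (k₄Owner? a b c d)

  -- `z` ends a critical path with middle `c` starting at `a`, `b` or `d`. The owner `c` comes last
  -- because it is to be recovered from the other four.
  Certifies : Fin n → Fin n → Fin n → Fin n → Fin n → Set
  Certifies a b d z c = Triangle a b c × (Crit a c z ⊎ Crit b c z ⊎ (K₄ a b c d × Crit d c z))

  certifies? : ∀ a b d z c → Dec (Certifies a b d z c)
  certifies? a b d z c =
    triangle? a b c ×-dec (crit? a c z ⊎-dec (crit? b c z ⊎-dec (k₄? a b c d ×-dec crit? d c z)))

  -- If `a` or `b` were adjacent to `z` and not the start of the critical path, it would be a common
  -- neighbour of start and `z`, hence equal to `c`; but it is adjacent to `c`.
  certifies⇒lonely : ∀ {a b d z c} → Certifies a b d z c → Lonely a b z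
  certifies⇒lonely {a} {b} ((ab , bc , ca) , inj₁ (_ , ¬az , only)) =
    ab , ¬az , λ bz → ~-irrefl (only b ab bz) bc
  certifies⇒lonely {a} {b} ((ab , bc , ca) , inj₂ (inj₁ (_ , ¬bz , only))) =
    ab , (λ az → ~-irrefl (≡.sym (only a (~-sym ab) az)) ca) , ¬bz
  certifies⇒lonely {a} {b} ((ab , bc , ca) , inj₂ (inj₂ ((_ , ad , bd , _) , (_ , _ , only)))) =
    ab , (λ az → ~-irrefl (≡.sym (only a (~-sym ad) az)) ca) , (λ bz → ~-irrefl (only b (~-sym bd) bz) bc)

  certifies-adjacent : ∀ {a b d z c} → Certifies a b d z c → c ~ z
  certifies-adjacent (_ , inj₁ (cz , _))               = cz
  certifies-adjacent (_ , inj₂ (inj₁ (cz , _)))        = cz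
  certifies-adjacent (_ , inj₂ (inj₂ (_ , (cz , _))))  = cz

  -- Both candidates are adjacent to `a`, `b` and `z`, so a critical path starting at `a` or `b` in
  -- either certificate identifies them. Hence in the mixed cases that path decides, not the one
  -- from `d`. If both paths start at `d`, both K₄'s give adjacency to `d`.
  certifies-unique : ∀ {a b d z c c′} → Certifies a b d z c → Certifies a b d z c′ → c ≡ c′
  certifies-unique {c′ = c′} (_ , inj₁ (_ , _ , only)) q@((_ , _ , c′a) , _) =
    ≡.sym (only c′ (~-sym c′a) (certifies-adjacent q))
  certifies-unique {c′ = c′} (_ , inj₂ (inj₁ (_ , _ , only))) q@((_ , bc′ , _) , _) =
    ≡.sym (only c′ bc′ (certifies-adjacent q))
  certifies-unique {c = c} p@((_ , _ , ca) , inj₂ (inj₂ _)) (_ , inj₁ (_ , _ , only)) =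
    only c (~-sym ca) (certifies-adjacent p)
  certifies-unique {c = c} p@((_ , bc , _) , inj₂ (inj₂ _)) (_ , inj₂ (inj₁ (_ , _ , only))) =
    only c bc (certifies-adjacent p)
  certifies-unique {c′ = c′} (_ , inj₂ (inj₂ (_ , (_ , _ , only)))) q@(_ , inj₂ (inj₂ ((_ , _ , _ , c′d) , _))) =
    ≡.sym (only c′ (~-sym c′d) (certifies-adjacent q))

  owners≤lonely : #triangleOwner + #k₄Owner ≤ n * #lonely
  owners≤lonely = begin
    #triangleOwner + #k₄Owner
      ≡⟨ Σ₄-distrib-+ (λ a b c d → 𝟙 (triangleOwner? a b c d)) (λ a b c d → 𝟙 (k₄Owner? a b c d)) ⟨
    Σ₄ (λ a b c d → 𝟙 (triangleOwner? a b c d) + 𝟙 (k₄Owner? a b c d))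
      ≤⟨ Σ₄-mono certified ⟩
    Σ₄ (λ a b c d → ∑[ z < n ] 𝟙 (certifies? a b d z c))
      -- Moves `c` innermost, so that the remaining sum over `c` has at most one nonzero term.
      ≡⟨ (sum-cong-≗ λ a → sum-cong-≗ λ b → Σ₃-rotate λ d z c → 𝟙 (certifies? a b d z c)) ⟩
    Σ₄ (λ a b d z → ∑[ c < n ] 𝟙 (certifies? a b d z c))
      ≤⟨ (Σ₄-mono λ a b d z → 𝟙-unique (lonely? a b z) (certifies? a b d z) certifies⇒lonely certifies-unique) ⟩
    Σ₄ (λ a b d z → 𝟙 (lonely? a b z))
      ≡⟨ Σ₄-const₃ (λ a b z → 𝟙 (lonely? a b z)) ⟩
    n * #lonely ∎
    where
    certified : ∀ a b c d → 𝟙 (triangleOwner? a b c d) + 𝟙 (k₄Owner? a b c d) ≤ ∑[ z < n ] 𝟙 (certifies? a b d z c)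
    certified a b c d = ℕ.≤-trans
      -- The two kinds of owner exclude each other, so a single certificate pays for both
      -- indicators.
      (𝟙-disjoint (triangleOwner? a b c d) (k₄Owner? a b c d) (any? (λ z → certifies? a b d z c))
        (λ { ((t , _) , inj₁ (z , p)) → z , t , inj₁ p
           ; ((t , _) , inj₂ (z , p)) → z , t , inj₂ (inj₁ p) })
        (λ { (k , inj₁ (z , p)) → z , proj₁ k , inj₁ p
           ; (k , inj₂ (inj₁ (z , p))) → z , proj₁ k , inj₂ (inj₁ p)
           ; (k , inj₂ (inj₂ (z , p))) → z , proj₁ k , inj₂ (inj₂ (k , p)) })
        λ { ((_ , ¬k) , _) (k , _) → ¬k k })
      (𝟙-∃ (any? (λ z → certifies? a b d z c)) (λ z → certifies? a b d z c) id)

  triangles≤lone+k₄ : n * #triangle ≤ #loneTriangle + #k₄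
  triangles≤lone+k₄ = begin
    n * #triangle
      ≡⟨ Σ₄-const₄ (λ a b c → 𝟙 (triangle? a b c)) ⟨
    Σ₄ (λ a b c d → 𝟙 (triangle? a b c))
      ≤⟨ Σ₄-mono pointwise ⟩
    Σ₄ (λ a b c d → 𝟙 (loneTriangle? a b c d) + 𝟙 (k₄? a b c d))
      ≡⟨ Σ₄-distrib-+ (λ a b c d → 𝟙 (loneTriangle? a b c d)) (λ a b c d → 𝟙 (k₄? a b c d)) ⟩
    #loneTriangle + #k₄ ∎
    where
    cover : ∀ a b c d → Triangle a b c → LoneTriangle a b c d ⊎ K₄ a b c d
    cover a b c d t with k₄? a b c d
    ... | yes k = inj₂ k
    ... | no ¬k = inj₁ (t , ¬k)
    pointwise : ∀ a b c d → 𝟙 (triangle? a b c) ≤ 𝟙 (loneTriangle? a b c d) + 𝟙 (k₄? a b c d)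
    pointwise a b c d = ℕ.≤-trans
      (𝟙-mono (triangle? a b c) (loneTriangle? a b c d ⊎-dec k₄? a b c d) (cover a b c d))
      (𝟙-⊎ (loneTriangle? a b c d) (k₄? a b c d))

  -- Owner counts under criticality, and the degree bound.

  module _ (critical : DiamCritical G 2) where

    -- The three rotations of a triangle bring each vertex once into the owner position `c`, and
    -- each rotation preserves the total count.
    2loneTriangles≤3owners : 2 * #loneTriangle ≤ 3 * #triangleOwner
    2loneTriangles≤3owners = begin
      2 * #loneTriangle
        ≡⟨ Σ₄-*ˡ 2 (λ a b c d → 𝟙 (loneTriangle? a b c d)) ⟩
      Σ₄ (λ a b c d → 2 * 𝟙 (loneTriangle? a b c d))
        ≤⟨ Σ₄-mono (λ a b c d → 𝟙-scale 2 (loneTriangle? a b c d) (pointwise a b c d)) ⟩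
      Σ₄ (λ a b c d → o a b c d + (o b c a d + o c a b d))
        ≡⟨ ≡.trans (Σ₄-distrib-+ o _) (cong (_+_ #triangleOwner)
             (Σ₄-distrib-+ (λ a b c d → o b c a d) (λ a b c d → o c a b d))) ⟩
      #triangleOwner + (Σ₄ (λ a b c d → o b c a d) + Σ₄ (λ a b c d → o c a b d))
        ≡⟨ cong (_+_ #triangleOwner) (cong₂ _+_
             (Σ₃-rotate (λ a b c → sum (o a b c))) (≡.sym (Σ₃-rotate (λ a b c → sum (o c a b))))) ⟩
      #triangleOwner + (#triangleOwner + #triangleOwner)
        ≡⟨ triple #triangleOwner ⟩
      3 * #triangleOwner ∎
      where
      o : Fin n → Fin n → Fin n → Fin n → ℕ
      o a b c d = 𝟙 (triangleOwner? a b c d)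
      triple : ∀ x → x + (x + x) ≡ 3 * x
      triple = solve-∀
      pointwise : ∀ a b c d → LoneTriangle a b c d → 2 ≤ o a b c d + (o b c a d + o c a b d)
      pointwise a b c d t@((ab , bc , ca) , ¬k) = two-of-three
        (triangleOwner? a b c d) (triangleOwner? b c a d) (triangleOwner? c a b d)
        (map-⊎ (λ c⟶a → t , inj₁ c⟶a) (λ a⟶c → at-a , inj₂ a⟶c) (triangle-edge-owned critical ca bc (~-sym ab)))
        (map-⊎ (λ a⟶b → at-a , inj₁ a⟶b) (λ b⟶a → at-b , inj₂ b⟶a) (triangle-edge-owned critical ab ca (~-sym bc)))
        (map-⊎ (λ b⟶c → at-b , inj₁ b⟶c) (λ c⟶b → t , inj₂ c⟶b) (triangle-edge-owned critical bc ab (~-sym ca)))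
        where
        at-a : LoneTriangle b c a d
        at-a = (bc , ca , ab) , ¬k ∘ K₄-rotate₃ ∘ K₄-rotate₃
        at-b : LoneTriangle c a b d
        at-b = (ca , ab , bc) , ¬k ∘ K₄-rotate₃

    3k₄≤4owners : 3 * #k₄ ≤ 4 * #k₄Owner
    3k₄≤4owners = begin
      3 * #k₄
        ≡⟨ Σ₄-*ˡ 3 (λ a b c d → 𝟙 (k₄? a b c d)) ⟩
      Σ₄ (λ a b c d → 3 * 𝟙 (k₄? a b c d))
        ≤⟨ Σ₄-mono (λ a b c d → 𝟙-scale 3 (k₄? a b c d) (pointwise a b c d)) ⟩
      Σ₄ (λ a b c d → o a b c d + (o b c d a + (o c d a b + o d a b c)))
        ≡⟨ ≡.trans (Σ₄-distrib-+ o _) (cong (_+_ #k₄Owner)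
             (≡.trans (Σ₄-distrib-+ (λ a b c d → o b c d a) _) (cong (_+_ _)
               (Σ₄-distrib-+ (λ a b c d → o c d a b) (λ a b c d → o d a b c))))) ⟩
      #k₄Owner + (Σ₄ (λ a b c d → o b c d a) + (Σ₄ (λ a b c d → o c d a b) + Σ₄ (λ a b c d → o d a b c)))
        ≡⟨ cong (_+_ #k₄Owner) (cong₂ _+_ (Σ₄-rotate o) (cong₂ _+_
             (≡.trans (Σ₄-rotate (λ a b c d → o b c d a)) (Σ₄-rotate o))
             (≡.sym (Σ₄-rotate (λ a b c d → o d a b c))))) ⟩
      #k₄Owner + (#k₄Owner + (#k₄Owner + #k₄Owner))
        ≡⟨ quadruple #k₄Owner ⟩
      4 * #k₄Owner ∎
      where
      o : Fin n → Fin n → Fin n → Fin n → ℕ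
      o a b c d = 𝟙 (k₄Owner? a b c d)
      quadruple : ∀ x → x + (x + (x + x)) ≡ 4 * x
      quadruple = solve-∀
      pointwise : ∀ a b c d → K₄ a b c d → 3 ≤ o a b c d + (o b c d a + (o c d a b + o d a b c))
      -- The four rotations test `c`, `d`, `a`, `b` in this order; the six clauses are the edges
      -- `cd`, `da`, `ac`, `cb`, `db`, `ab`.
      pointwise a b c d k@((ab , bc , ca) , ad , bd , cd) = three-of-four
        (k₄Owner? a b c d) (k₄Owner? b c d a) (k₄Owner? c d a b) (k₄Owner? d a b c)
        (map-⊎ (λ c⟶d → k  , inj₂ (inj₂ c⟶d)) (λ d⟶c → k₁ , inj₂ (inj₁ d⟶c)) (owned cd (~-sym ca) ad))
        (map-⊎ (λ d⟶a → k₁ , inj₂ (inj₂ d⟶a)) (λ a⟶d → k₂ , inj₂ (inj₁ a⟶d)) (owned (~-sym ad) bd (~-sym ab)))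
        (map-⊎ (λ a⟶c → k₂ , inj₁ a⟶c) (λ c⟶a → k , inj₁ c⟶a) (owned (~-sym ca) (~-sym ad) (~-sym cd)))
        (map-⊎ (λ c⟶b → k  , inj₂ (inj₁ c⟶b)) (λ b⟶c → k₃ , inj₂ (inj₂ b⟶c)) (owned (~-sym bc) (~-sym ca) ab))
        (map-⊎ (λ d⟶b → k₁ , inj₁ d⟶b) (λ b⟶d → k₃ , inj₁ b⟶d) (owned (~-sym bd) ad ab))
        (map-⊎ (λ a⟶b → k₂ , inj₂ (inj₂ a⟶b)) (λ b⟶a → k₃ , inj₂ (inj₁ b⟶a)) (owned ab ca (~-sym bc)))
        where
        owned : ∀ {u v t} → u ~ v → t ~ u → t ~ v → (u ⟶ v) ⊎ (v ⟶ u)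
        owned = triangle-edge-owned critical
        k₁ : K₄ b c d a
        k₁ = K₄-rotate k
        k₂ : K₄ c d a b
        k₂ = K₄-rotate k₁
        k₃ : K₄ d a b c
        k₃ = K₄-rotate k₂

    -- Twelve times the owner shares 2/3 and 3/4 gives 8 per lone triangle and 9 per K₄, so every K₄
    -- leaves one unit over.
    surplus : #k₄ + 8 * (n * #triangle) ≤ 12 * (n * #lonely)
    surplus = begin
      #k₄ + 8 * (n * #triangle)
        ≤⟨ ℕ.+-monoʳ-≤ #k₄ (ℕ.*-monoʳ-≤ 8 triangles≤lone+k₄) ⟩
      #k₄ + 8 * (#loneTriangle + #k₄)
        ≡⟨ split #k₄ #loneTriangle ⟩
      4 * (2 * #loneTriangle) + 3 * (3 * #k₄)
        ≤⟨ ℕ.+-mono-≤ (ℕ.*-monoʳ-≤ 4 2loneTriangles≤3owners) (ℕ.*-monoʳ-≤ 3 3k₄≤4owners) ⟩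
      4 * (3 * #triangleOwner) + 3 * (4 * #k₄Owner)
        ≡⟨ merge #triangleOwner #k₄Owner ⟩
      12 * (#triangleOwner + #k₄Owner)
        ≤⟨ ℕ.*-monoʳ-≤ 12 owners≤lonely ⟩
      12 * (n * #lonely) ∎
      where
      split : ∀ k l → k + 8 * (l + k) ≡ 4 * (2 * l) + 3 * (3 * k)
      split = solve-∀
      merge : ∀ t k → 4 * (3 * t) + 3 * (4 * k) ≡ 12 * (t + k)
      merge = solve-∀

    edge-degree-bound : .{{_ : ℕ.NonZero n}} → 12 * Σdeg² ≤ 7 * (n * #arcs)
    edge-degree-bound = ℕ.*-cancelˡ-≤ 7 (begin
      -- Of the 84 copies of `Σdeg²`, four go through the cubic estimate and eighty are split into
      -- triangles and cherries.
      7 * (12 * Σdeg²)                                   ≡⟨ split Σdeg² ⟩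
      4 * Σdeg² + 80 * Σdeg²                             ≤⟨ ℕ.+-monoʳ-≤ (4 * Σdeg²) (ℕ.*-monoʳ-≤ 80 Σdeg²≤) ⟩
      4 * Σdeg² + 80 * (#triangle + #cherry)             ≤⟨ ℕ.+-cancelʳ-≤ (12 * #cherry) _ _ bound ⟩
      7 * (7 * (n * #arcs))                              ∎)
      where
      split : ∀ s → 7 * (12 * s) ≡ 4 * s + 80 * s
      split = solve-∀

      -- Four copies of `surplus` absorb exactly the `4 * #k₄` coming from `4 * Σdeg³`. The common
      -- factor `n` arises from comparing fourfold with threefold counts.
      scaled : n * (4 * Σdeg² + 32 * #triangle) ≤ n * (48 * #lonely + 12 * #cherry + n * #arcs)
      scaled = begin
        n * (4 * Σdeg² + 32 * #triangle)
          ≡⟨ expand n Σdeg² #triangle ⟩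
        4 * (n * Σdeg²) + 32 * (n * #triangle)
          ≤⟨ ℕ.+-monoˡ-≤ _ Σdeg²≤Σdeg³ ⟩
        4 * Σdeg³ + n * n * #arcs + 32 * (n * #triangle)
          ≤⟨ ℕ.+-monoˡ-≤ (32 * (n * #triangle)) (ℕ.+-monoˡ-≤ (n * n * #arcs) (ℕ.*-monoʳ-≤ 4 Σdeg³≤)) ⟩
        4 * (#k₄ + 3 * (n * #cherry)) + n * n * #arcs + 32 * (n * #triangle)
          ≡⟨ regroup #k₄ n #cherry #arcs #triangle ⟩
        4 * (#k₄ + 8 * (n * #triangle)) + (12 * (n * #cherry) + n * n * #arcs)
          ≤⟨ ℕ.+-monoˡ-≤ _ (ℕ.*-monoʳ-≤ 4 surplus) ⟩
        4 * (12 * (n * #lonely)) + (12 * (n * #cherry) + n * n * #arcs)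
          ≡⟨ factor n #lonely #cherry #arcs ⟩
        n * (48 * #lonely + 12 * #cherry + n * #arcs) ∎
        where
        expand : ∀ n s t → n * (4 * s + 32 * t) ≡ 4 * (n * s) + 32 * (n * t)
        expand = solve-∀
        regroup : ∀ k n c w t → 4 * (k + 3 * (n * c)) + n * n * w + 32 * (n * t) ≡
                                4 * (k + 8 * (n * t)) + (12 * (n * c) + n * n * w)
        regroup = solve-∀
        factor : ∀ n l c w → 4 * (12 * (n * l)) + (12 * (n * c) + n * n * w) ≡ n * (48 * l + 12 * c + n * w)
        factor = solve-∀

      bound : 4 * Σdeg² + 80 * (#triangle + #cherry) + 12 * #cherry ≤ 7 * (7 * (n * #arcs)) + 12 * #cherry
      bound = begin
        4 * Σdeg² + 80 * (#triangle + #cherry) + 12 * #cherry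
          -- The padding brings the cherry coefficient to 96, so that 48 copies of
          -- `triples-on-edges` absorb it together with the `48 * #lonely` from `scaled`.
          ≤⟨ ℕ.m≤m+n _ (4 * #cherry) ⟩
        4 * Σdeg² + 80 * (#triangle + #cherry) + 12 * #cherry + 4 * #cherry
          ≡⟨ regroup Σdeg² #triangle #cherry ⟩
        4 * Σdeg² + 32 * #triangle + (48 * #triangle + 96 * #cherry)
          ≤⟨ ℕ.+-monoˡ-≤ _ (ℕ.*-cancelˡ-≤ n scaled) ⟩
        48 * #lonely + 12 * #cherry + n * #arcs + (48 * #triangle + 96 * #cherry)
          ≡⟨ collect #lonely #cherry #triangle (n * #arcs) ⟩
        48 * ((#triangle + #cherry) + (#cherry + #lonely)) + (n * #arcs + 12 * #cherry)
          ≤⟨ ℕ.+-monoˡ-≤ _ (ℕ.*-monoʳ-≤ 48 triples-on-edges) ⟩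
        48 * (n * #arcs) + (n * #arcs + 12 * #cherry)
          ≡⟨ merge (n * #arcs) #cherry ⟩
        7 * (7 * (n * #arcs)) + 12 * #cherry ∎
        where
        regroup : ∀ s t c → 4 * s + 80 * (t + c) + 12 * c + 4 * c ≡ 4 * s + 32 * t + (48 * t + 96 * c)
        regroup = solve-∀
        collect : ∀ l c t w → 48 * l + 12 * c + w + (48 * t + 96 * c) ≡ 48 * ((t + c) + (c + l)) + (w + 12 * c)
        collect = solve-∀
        merge : ∀ w c → 48 * w + (w + 12 * c) ≡ 7 * (7 * w) + 12 * c
        merge = solve-∀

  -- Return to `degree`, `sumSqDeg` and `edgeCount`.

  degree≡deg : ∀ a → degree G a ≡ deg a
  degree≡deg a = ≡.trans (sum-map-allFin (b2n ∘ adj G a)) (sum-cong-≗ λ b → indicator (adj G a b))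
    where
    indicator : ∀ x → b2n x ≡ 𝟙 (x Bool.≟ true)
    indicator true  = refl
    indicator false = refl

  sumSqDeg≡Σdeg² : sumSqDeg G ≡ Σdeg²
  sumSqDeg≡Σdeg² = ≡.trans (sum-map-allFin (λ a → degree G a * degree G a))
    (sum-cong-≗ λ a → cong₂ _*_ (degree≡deg a) (degree≡deg a))

  -- Adjacent vertices have different indices, so an arc or its reverse goes upwards; transposing
  -- the double sum gives two copies of `edgeCount`.
  #arcs≤ : #arcs ≤ 2 * edgeCount G
  #arcs≤ = begin
    #arcs
      ≤⟨ sum-mono-≤ (λ a → sum-mono-≤ (pointwise a)) ⟩
    sum (λ a → sum (λ b → up a b + up b a))
      ≡⟨ (sum-cong-≗ λ a → ∑-distrib-+ (up a) (λ b → up b a)) ⟩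
    sum (λ a → sum (up a) + sum (λ b → up b a))
      ≡⟨ ∑-distrib-+ (λ a → sum (up a)) (λ a → sum (λ b → up b a)) ⟩
    sum (λ a → sum (up a)) + sum (λ a → sum (λ b → up b a))
      ≡⟨ cong (_+_ _) (∑-comm up) ⟨
    sum (λ a → sum (up a)) + sum (λ a → sum (up a))
      ≡⟨ cong₂ _+_ edgeCount≡ (≡.trans (ℕ.+-identityʳ _) edgeCount≡) ⟨
    2 * edgeCount G ∎
    where
    up : Fin n → Fin n → ℕ
    up a b = b2n (adj G a b ∧ ⌊ toℕ a ℕ.<? toℕ b ⌋)
    edgeCount≡ : edgeCount G ≡ sum (λ a → sum (up a))
    edgeCount≡ = ≡.trans
      (sum-map-allFin (λ a → List.sum (map (up a) (allFin n)))) (sum-cong-≗ λ a → sum-map-allFin (up a))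
    pointwise : ∀ a b → 𝟙 (a ~? b) ≤ up a b + up b a
    pointwise a b with a ~? b
    ... | no _   = z≤n
    ... | yes ab rewrite ab | ~-sym ab with toℕ a ℕ.<? toℕ b | toℕ b ℕ.<? toℕ a
    ...   | yes _   | _       = s≤s z≤n
    ...   | no _    | yes _   = s≤s z≤n
    ...   | no a≮b  | no b≮a  =
      ⊥-elim (~-irrefl (toℕ-injective (ℕ.≤-antisym (ℕ.≮⇒≥ b≮a) (ℕ.≮⇒≥ a≮b))) ab)

  6sumSqDeg≤7nm : .{{_ : ℕ.NonZero n}} → DiamCritical G 2 → 6 * sumSqDeg G ≤ 7 * (n * edgeCount G)
  6sumSqDeg≤7nm critical = ℕ.*-cancelˡ-≤ 2 (begin
    2 * (6 * sumSqDeg G)              ≡⟨ cong (λ s → 2 * (6 * s)) sumSqDeg≡Σdeg² ⟩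
    2 * (6 * Σdeg²)                   ≡⟨ ℕ.*-assoc 2 6 Σdeg² ⟨
    12 * Σdeg²                        ≤⟨ edge-degree-bound critical ⟩
    7 * (n * #arcs)                   ≤⟨ ℕ.*-monoʳ-≤ 7 (ℕ.*-monoʳ-≤ n #arcs≤) ⟩
    7 * (n * (2 * edgeCount G))       ≡⟨ regroup n (edgeCount G) ⟩
    2 * (7 * (n * edgeCount G))       ∎)
    where
    regroup : ∀ n m → 7 * (n * (2 * m)) ≡ 2 * (7 * (n * m))
    regroup = solve-∀

-- Passage to rational numbers.

open import Data.Integer using (+_)
import Data.Integer as ℤ
import Data.Integer.Properties as ℤ
open import Data.Rational.Unnormalised using (mkℚᵘ)
import Data.Rational.Unnormalised as ℚᵘ
import Data.Rational.Unnormalised.Properties as ℚᵘ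
import Data.Rational as ℚ
import Data.Rational.Properties as ℚ
open import Data.Rational using (ℚ; _/_; _-_; _*_; _≤_; _<_; 0ℚ)

-- Unnormalised fractions multiply without reduction, so there the claim is plain
-- cross-multiplication with denominators 1 and 6.
≤-from-ℕ : ∀ s n m → 6 ℕ.* s ℕ.≤ 7 ℕ.* (n ℕ.* m) → + s / 1 ≤ (+ 7 / 6) * (+ n / 1) * (+ m / 1)
≤-from-ℕ s n m 6s≤7nm = ℚ.toℚᵘ-cancel-≤ (begin
  ℚ.toℚᵘ (+ s / 1)
    ≃⟨ ℚ.toℚᵘ-fromℚᵘ (mkℚᵘ (+ s) 0) ⟩
  mkℚᵘ (+ s) 0
    ≤⟨ ℚᵘ.*≤* cross ⟩
  -- The second argument of `mkℚᵘ` is the denominator minus one, so this factor is 7/6.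
  mkℚᵘ (+ 7) 5 ℚᵘ.* mkℚᵘ (+ n) 0 ℚᵘ.* mkℚᵘ (+ m) 0
    ≃⟨ ℚᵘ.*-cong (ℚᵘ.*-congˡ {mkℚᵘ (+ 7) 5} (ℚ.toℚᵘ-fromℚᵘ (mkℚᵘ (+ n) 0))) (ℚ.toℚᵘ-fromℚᵘ (mkℚᵘ (+ m) 0)) ⟨
  ℚ.toℚᵘ (+ 7 / 6) ℚᵘ.* ℚ.toℚᵘ (+ n / 1) ℚᵘ.* ℚ.toℚᵘ (+ m / 1)
    ≃⟨ ℚᵘ.*-congʳ (ℚ.toℚᵘ-homo-* (+ 7 / 6) (+ n / 1)) ⟨
  ℚ.toℚᵘ ((+ 7 / 6) * (+ n / 1)) ℚᵘ.* ℚ.toℚᵘ (+ m / 1)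
    ≃⟨ ℚ.toℚᵘ-homo-* ((+ 7 / 6) * (+ n / 1)) (+ m / 1) ⟨
  ℚ.toℚᵘ ((+ 7 / 6) * (+ n / 1) * (+ m / 1)) ∎)
  where
  open ℚᵘ.≤-Reasoning
  lhs : + s ℤ.* + 6 ≡ + (6 ℕ.* s)
  lhs = ≡.trans (≡.sym (ℤ.pos-* s 6)) (cong +_ (ℕ.*-comm s 6))
  rhs : (+ 7 ℤ.* + n ℤ.* + m) ℤ.* + 1 ≡ + (7 ℕ.* (n ℕ.* m))
  rhs = ≡.trans (ℤ.*-identityʳ _) (≡.trans (cong (ℤ._* + m) (≡.sym (ℤ.pos-* 7 n)))
    (≡.trans (≡.sym (ℤ.pos-* (7 ℕ.* n) m)) (cong +_ (ℕ.*-assoc 7 n m))))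
  cross : + s ℤ.* + 6 ℤ.≤ (+ 7 ℤ.* + n ℤ.* + m) ℤ.* + 1
  cross = ≡.subst₂ ℤ._≤_ (≡.sym lhs) (≡.sym rhs) (ℤ.+≤+ 6s≤7nm)

theorem1p4 : Σ ℚ λ c → 0ℚ < c × Σ ℕ λ N → ∀ n → n ≥ N → (G : Graph n) → DiamCritical G 2 →
    (+ sumSqDeg G / 1) ≤ ((+ 6 / 5) - c) * (+ n / 1) * (+ edgeCount G / 1)
-- 6/5 - 1/30 = 7/6, which holds by evaluation; `N = 1` makes `n` nonzero, so that it can be
-- cancelled.
theorem1p4 = + 1 / 30 , ℚ.*<* (ℤ.+<+ (s≤s z≤n)) , 1 , λ n n≥1 G critical →
  ≤-from-ℕ (sumSqDeg G) n (edgeCount G) (Counting.6sumSqDeg≤7nm G {{ℕ.>-nonZero n≥1}} critical)
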